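{- Let $G$ be a connected, triangle-free graph of order $n$ and minimum degree $\delta$, where $\delta\ge 3$ and $n\ge 6\delta$. Then $\rho(G)\le \rho(G(X_{n,\delta}))$.
   Context: For a connected graph $H$ of order $m\ge 2$ and vertex $v$, $\overline{\sigma}(v)=\frac{1}{m-1}\sum_{w\in V(H)} d(v,w)$; the remoteness is $\rho(H)=\max_v\overline{\sigma}(v)$. For a positive integer sequence $A=(a_1,a_2,\ldots)$ and nonnegative integer $p$, $\ell(A,p)$ is the smallest $k$ with $\sum_{i=1}^k a_i>p$. Let $A=(1,1,\delta-1,\delta-1,1,1,\delta-1,\delta-1,\ldots)$ repeat the block $(1,1,\delta-1,\delta-1)$ indefinitely. Then $X_{n,\delta}=(1,\delta,\delta-1,a_1,\ldots,a_\ell,\delta,r_{n,\delta})$ with $\ell=\ell(A,n-4\delta)$ and $r_{n,\delta}=n-3\delta-\sum_{i=1}^\ell a_i$. For a finite sequence $X=(x_0,\ldots,x_d)$ of positive integers, $G(X)$ is the graph whose vertex set is the disjoint union of independent sets $V_0,\ldots,V_d$ with $|V_i|=x_i$, in which every vertex of $V_i$ is adjacent to every vertex of $V_{i+1}$ for $0\le i<d$, and there are no other edges. -}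

module Defs where

open import Data.Nat using (ℕ; zero; suc; _+_; _*_; _∸_; _≤_; _<ᵇ_; _≡ᵇ_)
open import Data.Nat.DivMod using (_%_)
open import Data.Bool using (Bool; true; false; _∧_; _∨_; if_then_else_; not)
open import Data.Fin using (Fin; toℕ)
open import Data.Fin.Properties using () renaming (_≟_ to _≟ᶠ_)
open import Data.List using (List; []; _∷_; map; foldr; _++_; applyUpTo)
open import Data.Nat.ListAction using (sum)
open import Data.Bool.ListAction using (any)
open import Data.List.Base using (allFin)
open import Data.Product using (Σ; ∃; _×_; _,_)
open import Data.Empty using (⊥)
open import Data.Integer using (+_)
open import Data.Rational using (ℚ; _/_; _⊔_; 0ℚ)
open import Relation.Binary.PropositionalEquality using (_≡_)
open import Relation.Nullary.Decidable using (⌊_⌋)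

Graph : ℕ → Set
Graph n = Fin n → Fin n → Bool

IsSimple : ∀ {n} → Graph n → Set
IsSimple {n} G = (∀ (u v : Fin n) → G u v ≡ G v u) × (∀ (v : Fin n) → G v v ≡ false)

reach : ∀ {n} → Graph n → ℕ → Fin n → Fin n → Bool
reach {n} G zero    v w = ⌊ v ≟ᶠ w ⌋
reach {n} G (suc k) v w = reach G k v w ∨ any (λ u → G v u ∧ reach G k u w) (allFin n)

Connected : ∀ {n} → Graph n → Set
Connected {n} G = ∀ (v w : Fin n) → ∃ λ k → reach G k v w ≡ true

TriangleFree : ∀ {n} → Graph n → Set
TriangleFree {n} G = ∀ (u v w : Fin n) →
  G u v ≡ true → G v w ≡ true → G u w ≡ true → ⊥

count : ∀ {n} → (Fin n → Bool) → ℕ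
count {n} p = sum (map (λ w → if p w then 1 else 0) (allFin n))

degree : ∀ {n} → Graph n → Fin n → ℕ
degree G v = count (G v)

MinDegree : ∀ {n} → Graph n → ℕ → Set
MinDegree {n} G δ = (∀ (v : Fin n) → δ ≤ degree G v) × (∃ λ (v : Fin n) → degree G v ≡ δ)

-- least k < b with p k = true (returns b if none)
leastBelow : (ℕ → Bool) → ℕ → ℕ
leastBelow p b = go 0 b
  where
  go : ℕ → ℕ → ℕ
  go i zero    = b
  go i (suc m) = if p i then i else go (suc i) m

-- distance d(v,w): least length of a walk from v to w.
-- (Searched among 0..n; in a connected graph on n vertices it is ≤ n-1.)
dist : ∀ {n} → Graph n → Fin n → Fin n → ℕ
dist {n} G v w = leastBelow (λ k → reach G k v w) (suc n)

trans : ∀ {n} → Graph n → Fin n → ℕ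
trans {n} G v = sum (map (dist G v) (allFin n))

-- average distance σ̄(v) = σ(v)/(n-1) and remoteness ρ = max_v σ̄(v);
-- only meaningful for order n ≥ 2 (junk value 0 otherwise).
avgDist : ∀ {n} → Graph n → Fin n → ℚ
avgDist {zero}        G v = 0ℚ
avgDist {suc zero}    G v = 0ℚ
avgDist {suc (suc m)} G v = (+ trans G v) / suc m

remoteness : ∀ {n} → Graph n → ℚ
remoteness {n} G = foldr _⊔_ 0ℚ (map (avgDist G) (allFin n))

-- The graph G(X) for a sequence X = (x_0,…,x_d): vertices 0..Σx_i - 1,
-- consecutive blocks of sizes x_0, x_1, … form V_0, V_1, …

partOf : ℕ → List ℕ → ℕ
partOf i []       = 0
partOf i (x ∷ xs) = if i <ᵇ x then 0 else suc (partOf (i ∸ x) xs)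

GX : (X : List ℕ) → Graph (sum X)
GX X u v = (suc p ≡ᵇ q) ∨ (suc q ≡ᵇ p)
  where
  p = partOf (toℕ u) X
  q = partOf (toℕ v) X

-- The sequence A = (1,1,δ-1,δ-1,1,1,δ-1,δ-1,…), indexed from 1.

seqA : ℕ → ℕ → ℕ
seqA δ i = if ((i ∸ 1) % 4) <ᵇ 2 then 1 else δ ∸ 1

prefA : ℕ → ℕ → ℕ
prefA δ k = sum (applyUpTo (λ j → seqA δ (suc j)) k)

-- ℓ(A,p): smallest k with Σ_{i≤k} a_i > p (since a_i ≥ 1, k ≤ p+1)
ellA : ℕ → ℕ → ℕ
ellA δ p = leastBelow (λ k → p <ᵇ prefA δ k) (suc (suc p))

Xnδ : ℕ → ℕ → List ℕ
Xnδ n δ =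
  1 ∷ δ ∷ (δ ∸ 1) ∷ (applyUpTo (λ j → seqA δ (suc j)) ℓ ++ (δ ∷ r ∷ []))
  where
  ℓ = ellA δ (n ∸ 4 * δ)
  r = n ∸ 3 * δ ∸ prefA δ ℓ

-- Fix a vertex v and let S k be the number of vertices at distance at most k from v. Two adjacent
-- vertices have disjoint neighbourhoods, so an edge between layers k + 2 and k + 3 gives
-- S (k + 4) ≥ S k + 2δ. Hence, while layer k + 1 is nonempty, S k is at least the prefix sum
-- x₀ + … + x_k of the sequence that minimises all prefix sums at once, and X_{n,δ} is that sequence
-- up to x_{ℓ+2}. By the choice of ℓ, S (ℓ + 2) > n - 2δ, so no edge lies at distance ≥ ℓ + 4: there is
-- no layer ℓ + 5, and a vertex in layer ℓ + 4 has its δ neighbours in layer ℓ + 3. So the prefix sums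
-- of X_{n,δ} bound S to the end, and Σ d(v, w) ≤ Σ i · xᵢ, which is the transmission of V₀ in G(X_{n,δ}).
module Submission where

open import Defs
open import Data.Nat using (ℕ; _≤_; _*_)
open import Data.Rational using () renaming (_≤_ to _≤ℚ_)

open import Data.Nat using (zero; suc; pred; _+_; _∸_; _<_; _≤?_; _<?_; _≟_; _≤ᵇ_; _<ᵇ_; z≤n; s≤s; s≤s⁻¹)
open import Data.Nat.Properties
open import Data.Nat.DivMod using (_%_)
open import Data.Nat.ListAction using (sum)
open import Data.Nat.ListAction.Properties using (sum-++)
open import Data.Nat.Tactic.RingSolver using (solve-∀)
open import Data.Bool using (Bool; true; false; T; if_then_else_; _∧_)
open import Data.Bool.Properties using (T-≡; T-∨; T-∧)
open import Data.Empty using (⊥; ⊥-elim)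
open import Data.Fin as Fin using (Fin; toℕ)
open import Data.Fin.Properties using (any?; toℕ<n) renaming (_≟_ to _≟ᶠ_)
import Data.Integer as ℤ
import Data.Integer.Properties as ℤ
open import Data.List using (List; []; _∷_; _++_; map; take; drop; tabulate; applyUpTo; allFin)
open import Data.List.Properties using (map-tabulate; take++drop≡id; applyUpTo-∷ʳ; foldr-preservesᵇ; foldr-preservesᵒ)
open import Data.List.Membership.Propositional using (lose)
open import Data.List.Membership.Propositional.Properties using (∈-allFin)
open import Data.List.Relation.Unary.All using (All; []; _∷_; universal)
import Data.List.Relation.Unary.All.Properties as All
import Data.List.Relation.Unary.Any as Any
open import Data.List.Relation.Unary.Any.Properties using (any⁺; any⁻; map⁺)
open import Data.Product using (∃; _×_; _,_; proj₁; proj₂)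
import Data.Rational as ℚ
import Data.Rational.Properties as ℚ
import Data.Rational.Unnormalised as ℚᵘ
import Data.Rational.Unnormalised.Properties as ℚᵘ
open import Data.Sum using (_⊎_; inj₁; inj₂)
open import Function using (_∘_; id)
open import Function.Bundles using (Equivalence)
open import Relation.Nullary using (yes; no)
open import Relation.Nullary.Decidable using (⌊_⌋; toWitness; fromWitness)
open import Relation.Binary.PropositionalEquality
  using (_≡_; refl; sym; cong; cong₂; subst; module ≡-Reasoning) renaming (trans to ≡-trans)

-- Least elements of Boolean predicates

-- `hit` is conditional because a failed search returns its bound: `r ≡ b` says nothing about `p b`.
record Least (p : ℕ → Bool) (b r : ℕ) : Set where
  constructor least
  field
    below : ∀ j → j < r → p j ≡ false
    hit   : r < b → p r ≡ true
    bound : r ≤ b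

  minimal : ∀ {j} → p j ≡ true → r ≤ j
  minimal {j} pj with r ≤? j
  ... | yes r≤j = r≤j
  ... | no r≰j with () ← ≡-trans (sym pj) (below j (≰⇒> r≰j))

search-least : ∀ p (g : ℕ → ℕ → ℕ → ℕ) →
  (∀ b i → g b i 0 ≡ b) →
  (∀ b i m → g b i (suc m) ≡ (if p i then i else g b (suc i) m)) →
  ∀ b i m → i + m ≡ b → (∀ j → j < i → p j ≡ false) → Least p b (g b i m)
search-least p g g₀ g₊ b i zero eq ¬p rewrite g₀ b i | +-identityʳ i | eq =
  least ¬p (λ b<b → ⊥-elim (<-irrefl refl b<b)) ≤-refl
search-least p g g₀ g₊ b i (suc m) eq ¬p rewrite g₊ b i m with p i in pi
... | true  = least ¬p (λ _ → pi) (subst (i ≤_) eq (m≤m+n i (suc m)))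
... | false = search-least p g g₀ g₊ b (suc i) m (≡-trans (sym (+-suc i m)) eq) ¬p′
  where
  ¬p′ : ∀ j → j < suc i → p j ≡ false
  ¬p′ j (s≤s j≤i) with j ≟ i
  ... | yes refl = pi
  ... | no j≢i   = ¬p j (≤∧≢⇒< j≤i j≢i)

-- The search loop inside leastBelow is local there and has no name outside;
-- `loop` is solved by unification to be that loop.
mutual
  loop : (ℕ → Bool) → ℕ → ℕ → ℕ → ℕ
  loop = _

  leastBelow-least : ∀ p b → Least p b (leastBelow p b)
  leastBelow-least p zero = least (λ _ ()) (λ ()) z≤n
  leastBelow-least p (suc b) with p 0 in p0
  ... | true = least (λ _ ()) (λ _ → p0) z≤n
  -- With `suc b` and `1` generalised to variables, `loop` has only distinct variables as arguments,
  -- and pattern unification can solve for it.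
  ... | false with suc b in eqb | 1 in eq1
  ...   | c | i = search-least p (loop p) (λ _ _ → refl) (λ _ _ _ → refl) c i b
    (≡-trans (cong (_+ b) (sym eq1)) eqb)
    λ { zero _ → p0 ; (suc j) j<i → ⊥-elim (<⇒≱ j<i (subst (_≤ suc j) eq1 (s≤s z≤n))) }

-- The default `k` of the search satisfies `p` by hypothesis, so the result is a hit in every case.
least-true : ∀ p k → p k ≡ true → ∃ λ r → p r ≡ true × (∀ {j} → p j ≡ true → r ≤ j)
least-true p k pk = leastBelow p k , hits , minimal
  where
  open Least (leastBelow-least p k)
  hits : p (leastBelow p k) ≡ true
  hits with m≤n⇒m<n∨m≡n bound
  ... | inj₁ r<k = hit r<k
  ... | inj₂ r≡k = subst (λ r → p r ≡ true) (sym r≡k) pk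

-- Sums over Fin and counting

∑ : ∀ {n} → (Fin n → ℕ) → ℕ
∑ f = sum (tabulate f)

sum-map-allFin : ∀ {n} (f : Fin n → ℕ) → sum (map f (allFin n)) ≡ ∑ f
sum-map-allFin f = cong sum (map-tabulate id f)

∑-mono : ∀ {n} {f g : Fin n → ℕ} → (∀ x → f x ≤ g x) → ∑ f ≤ ∑ g
∑-mono {zero}  f≤g = z≤n
∑-mono {suc n} f≤g = +-mono-≤ (f≤g Fin.zero) (∑-mono (f≤g ∘ Fin.suc))

∑-+ : ∀ {n} (f g : Fin n → ℕ) → ∑ (λ x → f x + g x) ≡ ∑ f + ∑ g
∑-+ {zero}  f g = refl
∑-+ {suc n} f g = ≡-trans (cong (f₀ + g₀ +_) (∑-+ (f ∘ Fin.suc) (g ∘ Fin.suc)))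
  (+-interchange f₀ g₀ (∑ (f ∘ Fin.suc)) (∑ (g ∘ Fin.suc)))
  where
  f₀ g₀ : ℕ
  f₀ = f Fin.zero
  g₀ = g Fin.zero
  +-interchange : ∀ a b c d → a + b + (c + d) ≡ a + c + (b + d)
  +-interchange = solve-∀

∑-const : ∀ n c → ∑ {n} (λ _ → c) ≡ n * c
∑-const zero    c = refl
∑-const (suc n) c = cong (c +_) (∑-const n c)

≤-∑ : ∀ {n} (f : Fin n → ℕ) x → f x ≤ ∑ f
≤-∑ f Fin.zero    = m≤m+n (f Fin.zero) _
≤-∑ f (Fin.suc x) = ≤-trans (≤-∑ (f ∘ Fin.suc) x) (m≤n+m _ (f Fin.zero))

⟦_⟧ : Bool → ℕ
⟦ b ⟧ = if b then 1 else 0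

count≡∑ : ∀ {n} (p : Fin n → Bool) → count p ≡ ∑ (⟦_⟧ ∘ p)
count≡∑ p = sum-map-allFin (⟦_⟧ ∘ p)

none : ∀ {n} → Fin n → Bool
none _ = false

everything : ∀ {n} → Fin n → Bool
everything _ = true

count-everything : ∀ n → count (everything {n}) ≡ n
count-everything n = ≡-trans (count≡∑ (everything {n})) (≡-trans (∑-const n 1) (*-identityʳ n))

1≤count : ∀ {n} (p : Fin n → Bool) x → p x ≡ true → 1 ≤ count p
1≤count p x px = subst (1 ≤_) (sym (count≡∑ p))
  (≤-trans (≤-reflexive (sym (cong ⟦_⟧ px))) (≤-∑ (⟦_⟧ ∘ p) x))

infix 4 _⊆_ _∥_

_⊆_ _∥_ : ∀ {n} → (Fin n → Bool) → (Fin n → Bool) → Set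
p ⊆ q = ∀ x → p x ≡ true → q x ≡ true
p ∥ q = ∀ x → p x ≡ true → q x ≡ true → ⊥

count-disjoint : ∀ {n} {a b c d : Fin n → Bool} →
  a ⊆ d → b ⊆ d → c ⊆ d → a ∥ b → a ∥ c → b ∥ c →
  count a + count b + count c ≤ count d
count-disjoint {a = a} {b} {c} {d} a⊆d b⊆d c⊆d a∥b a∥c b∥c = begin
  count a + count b + count c          ≡⟨ cong₂ _+_ (cong₂ _+_ (count≡∑ a) (count≡∑ b)) (count≡∑ c) ⟩
  ∑ (⟦_⟧ ∘ a) + ∑ (⟦_⟧ ∘ b) + ∑ (⟦_⟧ ∘ c) ≡⟨ cong (_+ ∑ (⟦_⟧ ∘ c)) (∑-+ (⟦_⟧ ∘ a) (⟦_⟧ ∘ b)) ⟨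
  ∑ (λ x → ⟦ a x ⟧ + ⟦ b x ⟧) + ∑ (⟦_⟧ ∘ c) ≡⟨ ∑-+ (λ x → ⟦ a x ⟧ + ⟦ b x ⟧) (⟦_⟧ ∘ c) ⟨
  ∑ (λ x → ⟦ a x ⟧ + ⟦ b x ⟧ + ⟦ c x ⟧)   ≤⟨ ∑-mono (λ x → pointwise (a x) (b x) (c x) (d x)
                                              (a⊆d x) (b⊆d x) (c⊆d x) (a∥b x) (a∥c x) (b∥c x)) ⟩
  ∑ (⟦_⟧ ∘ d)                           ≡⟨ count≡∑ d ⟨
  count d                               ∎
  where
  open ≤-Reasoning
  pointwise : ∀ a b c d → (a ≡ true → d ≡ true) → (b ≡ true → d ≡ true) → (c ≡ true → d ≡ true) →
    (a ≡ true → b ≡ true → ⊥) → (a ≡ true → c ≡ true → ⊥) → (b ≡ true → c ≡ true → ⊥) →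
    ⟦ a ⟧ + ⟦ b ⟧ + ⟦ c ⟧ ≤ ⟦ d ⟧
  pointwise true  true  c     d     _ _ _ ab _ _ = ⊥-elim (ab refl refl)
  pointwise true  false true  d     _ _ _ _ ac _ = ⊥-elim (ac refl refl)
  pointwise false true  true  d     _ _ _ _ _ bc = ⊥-elim (bc refl refl)
  pointwise true  false false d     ad _ _ _ _ _ rewrite ad refl = ≤-refl
  pointwise false true  false d     _ bd _ _ _ _ rewrite bd refl = ≤-refl
  pointwise false false true  d     _ _ cd _ _ _ rewrite cd refl = ≤-refl
  pointwise false false false d     _ _ _ _ _ _  = z≤n

count-disjoint₂ : ∀ {n} {a b d : Fin n → Bool} →
  a ⊆ d → b ⊆ d → a ∥ b → count a + count b ≤ count d
count-disjoint₂ {n} {a} {b} {d} a⊆d b⊆d a∥b = ≤-trans (m≤m+n _ (count (none {n})))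
  (count-disjoint {c = none} a⊆d b⊆d (λ _ ()) a∥b (λ _ _ ()) (λ _ _ ()))

count-⊆ : ∀ {n} {a d : Fin n → Bool} → a ⊆ d → count a ≤ count d
count-⊆ {n} {a} {d} a⊆d = ≤-trans (m≤m+n _ (count (none {n})))
  (count-disjoint₂ {b = none} a⊆d (λ _ ()) (λ _ _ ()))

T⇒≡ : ∀ {b} → T b → b ≡ true
T⇒≡ = Equivalence.to T-≡

≡⇒T : ∀ {b} → b ≡ true → T b
≡⇒T = Equivalence.from T-≡

-- Σ i · xᵢ for the sequence x₀, x₁, …

weight : List ℕ → ℕ
weight []       = 0
weight (x ∷ xs) = sum xs + weight xs

-- Layer-cake summation: `∑ f` adds up the numbers of points with `f x > k`, and `weight X` adds up
-- the sums of the proper tails of `X`. Passing from `f` to `pred f` and from `X` to its tail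
-- removes the threshold `k = 0`.
∑≤weight : ∀ {n} (f : Fin n → ℕ) X →
  (∀ k → count (λ x → k <ᵇ f x) ≤ sum (drop (suc k) X)) → ∑ f ≤ weight X
∑≤weight {n} f [] tails = ≤-trans (∑-mono f≤0) (≤-reflexive (≡-trans (∑-const n 0) (*-zeroʳ n)))
  where
  f≤0 : ∀ x → f x ≤ 0
  f≤0 x = ≮⇒≥ λ 0<fx → <⇒≱ (1≤count (λ x → 0 <ᵇ f x) x (T⇒≡ (<⇒<ᵇ 0<fx))) (tails 0)
∑≤weight f (x ∷ xs) tails = begin
  ∑ f                                               ≤⟨ ∑-mono (λ y → split (f y)) ⟩
  ∑ (λ y → ⟦ 0 <ᵇ f y ⟧ + pred (f y))               ≡⟨ ∑-+ (λ y → ⟦ 0 <ᵇ f y ⟧) (pred ∘ f) ⟩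
  ∑ (λ y → ⟦ 0 <ᵇ f y ⟧) + ∑ (pred ∘ f)             ≡⟨ cong (_+ ∑ (pred ∘ f)) (count≡∑ (λ y → 0 <ᵇ f y)) ⟨
  count (λ y → 0 <ᵇ f y) + ∑ (pred ∘ f)             ≤⟨ +-mono-≤ (tails 0) (∑≤weight (pred ∘ f) xs tails′) ⟩
  sum xs + weight xs                                ∎
  where
  open ≤-Reasoning
  split : ∀ m → m ≤ ⟦ 0 <ᵇ m ⟧ + pred m
  split zero    = z≤n
  split (suc m) = ≤-refl
  shift : ∀ k m → (k <ᵇ pred m) ≡ true → (suc k <ᵇ m) ≡ true
  shift k (suc m) k<m = k<m
  tails′ : ∀ k → count (λ y → k <ᵇ pred (f y)) ≤ sum (drop (suc k) xs)
  tails′ k = ≤-trans (count-⊆ (λ y → shift k (f y))) (tails (suc k))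

∑-split-≤ : ∀ m {n} (g : ℕ → ℕ) → ∑ {n} (λ w → g (m + toℕ w)) ≤ ∑ {m + n} (g ∘ toℕ)
∑-split-≤ zero    g = ≤-refl
∑-split-≤ (suc m) g = ≤-trans (∑-split-≤ m (g ∘ suc)) (m≤n+m _ (g 0))

partOf-+ : ∀ x i xs → partOf (x + i) (x ∷ xs) ≡ suc (partOf i xs)
partOf-+ x i xs with x + i <ᵇ x in x+i<x
... | true  = ⊥-elim (<⇒≱ (<ᵇ⇒< (x + i) x (≡⇒T x+i<x)) (m≤m+n x i))
... | false = cong (λ j → suc (partOf j xs)) (m+n∸m≡n x i)

weight≤∑partOf : ∀ X → weight X ≤ ∑ {sum X} (λ w → partOf (toℕ w) X)
weight≤∑partOf []       = z≤n
weight≤∑partOf (x ∷ xs) = begin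
  sum xs + weight xs                 ≤⟨ +-monoʳ-≤ (sum xs) (weight≤∑partOf xs) ⟩
  sum xs + ∑ h                       ≡⟨ cong (_+ ∑ h) (≡-trans (∑-const (sum xs) 1) (*-identityʳ (sum xs))) ⟨
  ∑ {sum xs} (λ _ → 1) + ∑ h         ≡⟨ ∑-+ (λ _ → 1) h ⟨
  ∑ (suc ∘ h)                        ≤⟨ ∑-mono {sum xs} (λ w → ≤-reflexive (sym (partOf-+ x (toℕ w) xs))) ⟩
  ∑ {sum xs} (λ w → g (x + toℕ w))   ≤⟨ ∑-split-≤ x g ⟩
  ∑ {x + sum xs} (g ∘ toℕ)           ∎
  where
  open ≤-Reasoning
  g : ℕ → ℕ
  g i = partOf i (x ∷ xs)
  h : Fin (sum xs) → ℕ
  h w = partOf (toℕ w) xs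

-- Positive entries make every skipped block use up at least one index.
partOf≤ : ∀ i {X} → All (1 ≤_) X → partOf i X ≤ i
partOf≤ i []                   = z≤n
partOf≤ i {x ∷ xs} (1≤x ∷ 1≤X) with i <ᵇ x in i<x
... | true  = z≤n
... | false = begin-strict
  partOf (i ∸ x) xs ≤⟨ partOf≤ (i ∸ x) 1≤X ⟩
  i ∸ x             <⟨ ∸-monoʳ-< 1≤x x≤i ⟩
  i                 ∎
  where
  open ≤-Reasoning
  x≤i : x ≤ i
  x≤i = ≮⇒≥ λ i<x′ → case-⊥ (≡-trans (sym (T⇒≡ (<⇒<ᵇ i<x′))) i<x)
    where
    case-⊥ : true ≡ false → ⊥
    case-⊥ ()

-- Walks

module _ {n} (G : Graph n) where

  reach-keep : ∀ {k v w} → reach G k v w ≡ true → reach G (suc k) v w ≡ true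
  reach-keep r = T⇒≡ (Equivalence.from T-∨ (inj₁ (≡⇒T r)))

  reach-cons : ∀ {k v u w} → G v u ≡ true → reach G k u w ≡ true → reach G (suc k) v w ≡ true
  reach-cons {k} {v} {u} {w} e r = T⇒≡ (Equivalence.from T-∨ (inj₂ (any⁺ _ (lose (∈-allFin u)
    (Equivalence.from T-∧ (≡⇒T e , ≡⇒T r))))))

  reach-uncons : ∀ k {v w} → reach G (suc k) v w ≡ true →
    reach G k v w ≡ true ⊎ ∃ λ u → G v u ≡ true × reach G k u w ≡ true
  reach-uncons k r with Equivalence.to T-∨ (≡⇒T r)
  ... | inj₁ r′ = inj₁ (T⇒≡ r′)
  ... | inj₂ s with Any.satisfied (any⁻ _ (allFin n) s)
  ...   | u , t with Equivalence.to T-∧ t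
  ...     | e , r′ = inj₂ (u , T⇒≡ e , T⇒≡ r′)

  reach-refl : ∀ {v} → reach G 0 v v ≡ true
  reach-refl {v} = T⇒≡ (fromWitness {a? = v ≟ᶠ v} refl)

  reach-0 : ∀ {v w} → reach G 0 v w ≡ true → v ≡ w
  reach-0 {v} {w} r = toWitness {a? = v ≟ᶠ w} (≡⇒T r)

  -- `reach` splits a walk at its first edge, while distances from a fixed `v` change along the last
  -- edge. This lemma and `reach-unsnoc` move the split to the other end.
  reach-snoc : ∀ k {v u w} → reach G k v u ≡ true → G u w ≡ true → reach G (suc k) v w ≡ true
  reach-snoc zero    r e with refl ← reach-0 r = reach-cons {0} e reach-refl
  reach-snoc (suc k) r e with reach-uncons k r
  ... | inj₁ r′           = reach-keep {suc k} (reach-snoc k r′ e)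
  ... | inj₂ (_ , e′ , r′) = reach-cons {suc k} e′ (reach-snoc k r′ e)

  reach-unsnoc : ∀ k {v w} → reach G (suc k) v w ≡ true →
    reach G k v w ≡ true ⊎ ∃ λ u → reach G k v u ≡ true × G u w ≡ true
  reach-unsnoc k r with reach-uncons k r
  reach-unsnoc k       r | inj₁ r′ = inj₁ r′
  reach-unsnoc zero    r | inj₂ (u , e , r′) with refl ← reach-0 r′ = inj₂ (_ , reach-refl , e)
  reach-unsnoc (suc k) r | inj₂ (u , e , r′) with reach-unsnoc k r′
  ... | inj₁ r″            = inj₁ (reach-cons {k} e r″)
  ... | inj₂ (t , r″ , e′) = inj₂ (t , reach-cons {k} e r″ , e′)

-- Edges of `GX X` join consecutive parts only, so each step of a walk raises the part index by at
-- most one.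
reach-GX : ∀ X k {u w} → reach (GX X) k u w ≡ true → partOf (toℕ w) X ≤ k + partOf (toℕ u) X
reach-GX X zero    r with refl ← reach-0 (GX X) r = ≤-refl
reach-GX X (suc k) r with reach-uncons (GX X) k r
... | inj₁ r′ = m≤n⇒m≤1+n (reach-GX X k r′)
... | inj₂ (t , e , r′) with Equivalence.to T-∨ (≡⇒T e)
...   | inj₁ s = ≤-trans (reach-GX X k r′)
  (≤-trans (+-monoʳ-≤ k (≤-reflexive (sym (≡ᵇ⇒≡ _ _ s)))) (≤-reflexive (+-suc k _)))
...   | inj₂ s = m≤n⇒m≤1+n (≤-trans (reach-GX X k r′)
  (+-monoʳ-≤ k (≤-trans (n≤1+n _) (≤-reflexive (≡ᵇ⇒≡ _ _ s)))))

-- Prefix sums of X_{n,δ}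

-- This is x₀ + … + x_k only while k ≤ ℓ + 2: the closing entries δ, r are left out.
prefX : ℕ → ℕ → ℕ
prefX δ zero          = 1
prefX δ (suc zero)    = 1 + δ
prefX δ (suc (suc j)) = 1 + (δ + (δ ∸ 1 + prefA δ j))

seqA≥1 : ∀ {δ} → 2 ≤ δ → ∀ i → 1 ≤ seqA δ i
seqA≥1 2≤δ i with (i ∸ 1) % 4 <ᵇ 2
... | true  = ≤-refl
... | false = ∸-monoˡ-≤ 1 2≤δ

seqA≤ : ∀ {δ} → 2 ≤ δ → ∀ i → seqA δ i ≤ δ ∸ 1
seqA≤ 2≤δ i with (i ∸ 1) % 4 <ᵇ 2
... | true  = ∸-monoˡ-≤ 1 2≤δ
... | false = ≤-refl

prefA-suc : ∀ δ k → prefA δ (suc k) ≡ prefA δ k + seqA δ (suc k)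
prefA-suc δ k = begin
  sum (applyUpTo a (suc k))           ≡⟨ cong sum (applyUpTo-∷ʳ a k) ⟨
  sum (applyUpTo a k ++ a k ∷ [])     ≡⟨ sum-++ (applyUpTo a k) _ ⟩
  prefA δ k + (a k + 0)               ≡⟨ cong (prefA δ k +_) (+-identityʳ (a k)) ⟩
  prefA δ k + a k                     ∎
  where
  open ≡-Reasoning
  a : ℕ → ℕ
  a j = seqA δ (suc j)

k≤prefA : ∀ {δ} → 2 ≤ δ → ∀ k → k ≤ prefA δ k
k≤prefA 2≤δ zero = z≤n
k≤prefA {δ} 2≤δ (suc k) = begin
  suc k                       ≡⟨ +-comm 1 k ⟩
  k + 1                       ≤⟨ +-mono-≤ (k≤prefA 2≤δ k) (seqA≥1 2≤δ (suc k)) ⟩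
  prefA δ k + seqA δ (suc k)  ≡⟨ prefA-suc δ k ⟨
  prefA δ (suc k)             ∎
  where open ≤-Reasoning

-- The four entries added are a cyclic rotation of the block 1, 1, δ - 1, δ - 1, of sum 2δ. Starting
-- one index earlier would exchange a δ - 1 for δ, hence the offset `1 + k`.
prefX-+4 : ∀ e k → prefX (suc e) (5 + k) ≡ prefX (suc e) (1 + k) + (suc e + suc e)
prefX-+4 e zero = lemma e
  where
  lemma : ∀ e → 1 + (suc e + (e + (1 + (1 + (e + 0))))) ≡ 1 + suc e + (suc e + suc e)
  lemma = solve-∀
-- `(4 + i) % 4` computes to `i % 4`, so `prefA` at `4 + j` unfolds to one block plus `prefA` at
-- `j`.
prefX-+4 e (suc j) = lemma e (prefA (suc e) j)
  where
  lemma : ∀ e p → 1 + (suc e + (e + (1 + (1 + (e + (e + p)))))) ≡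
    1 + (suc e + (e + p)) + (suc e + suc e)
  lemma = solve-∀

-- As `k ≤ prefA δ k`, the index `suc p` is a hit, and it lies below the search bound `suc (suc p)`;
-- so the search succeeds.
ellA-hit : ∀ {δ} → 2 ≤ δ → ∀ p → p < prefA δ (ellA δ p)
ellA-hit {δ} 2≤δ p = <ᵇ⇒< p _ (≡⇒T (hit (s≤s (minimal (T⇒≡ (<⇒<ᵇ (k≤prefA 2≤δ (suc p))))))))
  where open Least (leastBelow-least (λ k → p <ᵇ prefA δ k) (suc (suc p)))

-- By minimality the sum without the last entry is at most `p`, and one entry adds at most `δ ∸ 1`.
-- This keeps the final entry `r` of the sequence positive.
prefA-ellA≤ : ∀ {δ} → 2 ≤ δ → ∀ p → prefA δ (ellA δ p) ≤ p + (δ ∸ 1)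
prefA-ellA≤ {δ} 2≤δ p = bounded (ellA δ p) below
  where
  open Least (leastBelow-least (λ k → p <ᵇ prefA δ k) (suc (suc p)))
  bounded : ∀ ℓ → (∀ j → j < ℓ → (p <ᵇ prefA δ j) ≡ false) → prefA δ ℓ ≤ p + (δ ∸ 1)
  bounded zero    _ = z≤n
  bounded (suc l) b = ≤-trans (≤-reflexive (prefA-suc δ l)) (+-mono-≤ prefA≤p (seqA≤ 2≤δ (suc l)))
    where
    prefA≤p : prefA δ l ≤ p
    prefA≤p = ≮⇒≥ λ p<l → true≢false (≡-trans (sym (T⇒≡ (<⇒<ᵇ p<l))) (b l ≤-refl))
      where
      true≢false : true ≡ false → ⊥
      true≢false ()

sum-take≤ : ∀ k X → sum (take k X) ≤ sum X
sum-take≤ k X = ≤-trans (m≤m+n _ (sum (drop k X)))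
  (≤-reflexive (≡-trans (sym (sum-++ (take k X) (drop k X))) (cong sum (take++drop≡id k X))))

take-applyUpTo-++ : ∀ (f : ℕ → ℕ) {j ℓ} ys → j ≤ ℓ → take j (applyUpTo f ℓ ++ ys) ≡ applyUpTo f j
take-applyUpTo-++ f ys z≤n       = refl
take-applyUpTo-++ f ys (s≤s j≤ℓ) = cong (f 0 ∷_) (take-applyUpTo-++ (f ∘ suc) ys j≤ℓ)

take-applyUpTo-∷ : ∀ (f : ℕ → ℕ) ℓ y ys →
  take (suc ℓ) (applyUpTo f ℓ ++ y ∷ ys) ≡ applyUpTo f ℓ ++ y ∷ []
take-applyUpTo-∷ f zero    y ys = refl
take-applyUpTo-∷ f (suc ℓ) y ys = cong (f 0 ∷_) (take-applyUpTo-∷ (f ∘ suc) ℓ y ys)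

sum-prefX : ∀ δ ℓ r →
  sum (1 ∷ δ ∷ δ ∸ 1 ∷ (applyUpTo (λ j → seqA δ (suc j)) ℓ ++ δ ∷ r ∷ [])) ≡ prefX δ (2 + ℓ) + (δ + r)
sum-prefX δ ℓ r = ≡-trans
  (cong (λ z → 1 + (δ + (δ ∸ 1 + z))) (sum-++ (applyUpTo (λ j → seqA δ (suc j)) ℓ) _))
  (lemma δ (δ ∸ 1) (prefA δ ℓ) r)
  where
  lemma : ∀ d e p r → 1 + (d + (e + (p + (d + (r + 0))))) ≡ 1 + (d + (e + p)) + (d + r)
  lemma = solve-∀

-- Distance layers of a triangle-free graph

-- `D` stands for any function with these three properties of the distance from `v`. Writing the
-- degree bound as `suc e` lets `δ ∸ 1` compute to `e`.
module Layers {n} (G : Graph n) (G-sym : ∀ u w → G u w ≡ G w u) (triangle-free : TriangleFree G)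
  (e : ℕ) (minDegree : ∀ u → suc e ≤ degree G u)
  (D : Fin n → ℕ) (v : Fin n) (D-v : D v ≡ 0)
  (D-lipschitz : ∀ {u w} → G u w ≡ true → D w ≤ suc (D u))
  (D-predecessor : ∀ {k w} → D w ≡ suc k → ∃ λ u → G u w ≡ true × D u ≡ k)
  where

  δ : ℕ
  δ = suc e

  within : ℕ → Fin n → Bool
  within k x = D x ≤ᵇ k

  S : ℕ → ℕ
  S k = count (within k)

  within⁺ : ∀ {k x} → D x ≤ k → within k x ≡ true
  within⁺ D≤k = T⇒≡ (≤⇒≤ᵇ D≤k)

  within⁻ : ∀ {k} x → within k x ≡ true → D x ≤ k
  within⁻ {k} x w = ≤ᵇ⇒≤ (D x) k (≡⇒T w)

  flip-edge : ∀ {u w} → G u w ≡ true → G w u ≡ true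
  flip-edge {u} {w} uw = ≡-trans (G-sym w u) uw

  S≤n : ∀ k → S k ≤ n
  S≤n k = ≤-trans (count-⊆ {n} {within k} {everything} (λ _ _ → refl)) (≤-reflexive (count-everything n))

  n≤S : ∀ k → (∀ x → D x ≤ k) → n ≤ S k
  n≤S k D≤k = ≤-trans (≤-reflexive (sym (count-everything n)))
    (count-⊆ {n} {everything} {within k} (λ x _ → within⁺ (D≤k x)))

  level : ∀ {k} x → k ≤ D x → ∃ λ w → D w ≡ k
  level {k} x k≤D = descend (D x) x refl k≤D
    where
    descend : ∀ d x → D x ≡ d → k ≤ d → ∃ λ w → D w ≡ k
    descend zero x Dx≡0 z≤n = x , Dx≡0
    descend (suc d) x Dx≡1+d k≤1+d with m≤n⇒m<n∨m≡n k≤1+d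
    ... | inj₂ refl      = x , Dx≡1+d
    ... | inj₁ (s≤s k≤d) with D-predecessor Dx≡1+d
    ...   | u , _ , Du≡d = descend d u Du≡d k≤d

  level-edge : ∀ {k} x → k < D x → ∃ λ u → ∃ λ w → G u w ≡ true × D u ≡ k × D w ≡ suc k
  level-edge x k<D with level x k<D
  ... | w , Dw with D-predecessor Dw
  ...   | u , uw , Du = u , w , uw , Du , Dw

  neighbours-disjoint : ∀ {u w} → G u w ≡ true → G u ∥ G w
  neighbours-disjoint {u} {w} uw x ux wx = triangle-free u w x uw wx ux

  neighbours-within : ∀ {k u} → D u ≤ k → G u ⊆ within (suc k)
  neighbours-within Du≤k x ux = within⁺ (≤-trans (D-lipschitz ux) (s≤s Du≤k))

  neighbours-beyond : ∀ {k u} → 2 + k ≤ D u → within k ∥ G u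
  neighbours-beyond {k} {u} 2+k≤Du x x≤k ux = <⇒≱ (≤-trans 2+k≤Du (D-lipschitz (flip-edge ux))) (s≤s (within⁻ x x≤k))

  -- The two neighbourhoods are disjoint by triangle-freeness, and they avoid the ball of radius `k`
  -- because `u` and `w` lie at distance at least `2 + k`. The radius `m` is free, so that both the
  -- four-layer step and edges arbitrarily far from `v` are covered.
  S-edge : ∀ {k m u w} → G u w ≡ true → 2 + k ≤ D u → 2 + k ≤ D w → k ≤ m → D u ≤ m → D w ≤ m →
    S k + (δ + δ) ≤ S (suc m)
  S-edge {k} {m} {u} {w} uw k<Du k<Dw k≤m Du≤m Dw≤m = begin
    S k + (δ + δ)                   ≤⟨ +-monoʳ-≤ (S k) (+-mono-≤ (minDegree u) (minDegree w)) ⟩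
    S k + (degree G u + degree G w) ≡⟨ +-assoc (S k) (degree G u) (degree G w) ⟨
    S k + degree G u + degree G w   ≤⟨ count-disjoint
      (λ x x≤k → within⁺ (≤-trans (within⁻ x x≤k) (m≤n⇒m≤1+n k≤m)))
      (neighbours-within Du≤m) (neighbours-within Dw≤m)
      (neighbours-beyond k<Du) (neighbours-beyond k<Dw) (neighbours-disjoint uw) ⟩
    S (suc m)                       ∎
    where open ≤-Reasoning

  S-suc : ∀ k x → k < D x → S k + 1 ≤ S (suc k)
  S-suc k x k<D with level x k<D
  ... | w , Dw = ≤-trans
    (+-monoʳ-≤ (S k) (1≤count (λ y → ⌊ w ≟ᶠ y ⌋) w (T⇒≡ (fromWitness {a? = w ≟ᶠ w} refl))))
    (count-disjoint₂ {b = λ y → ⌊ w ≟ᶠ y ⌋} (λ y y≤k → within⁺ (m≤n⇒m≤1+n (within⁻ y y≤k)))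
      (λ y w≡y → within⁺ (≤-reflexive (≡-trans (sym (cong D (toWitness {a? = w ≟ᶠ y} (≡⇒T w≡y)))) Dw)))
      (λ y y≤k w≡y → 1+n≰n (≤-trans (≤-reflexive (sym Dw))
        (≤-trans (≤-reflexive (cong D (toWitness {a? = w ≟ᶠ y} (≡⇒T w≡y)))) (within⁻ y y≤k)))))

  S-+4 : ∀ k x → 4 + k ≤ D x → S k + (δ + δ) ≤ S (4 + k)
  S-+4 k x 4+k≤D with level-edge {2 + k} x (≤-trans (n≤1+n _) 4+k≤D)
  ... | u , w , uw , Du , Dw = S-edge uw (≤-reflexive (sym Du)) (≤-trans (n≤1+n _) (≤-reflexive (sym Dw)))
    (m≤n+m k 3) (≤-trans (≤-reflexive Du) (n≤1+n _)) (≤-reflexive Dw)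

  S₀ : 1 ≤ S 0
  S₀ = 1≤count (within 0) v (within⁺ (≤-reflexive D-v))

  S₁ : 1 + δ ≤ S 1
  S₁ = ≤-trans
    (+-mono-≤ (1≤count (λ y → ⌊ v ≟ᶠ y ⌋) v (T⇒≡ (fromWitness {a? = v ≟ᶠ v} refl))) (minDegree v))
    (count-disjoint₂ {a = λ y → ⌊ v ≟ᶠ y ⌋}
      (λ y v≡y → within⁺ (≤-trans (≤-reflexive (≡-trans (sym (cong D (toWitness {a? = v ≟ᶠ y} (≡⇒T v≡y)))) D-v)) z≤n))
      (neighbours-within (≤-reflexive D-v))
      (λ y v≡y vy → no-loop y v≡y vy))
    where
    no-loop : ∀ y → ⌊ v ≟ᶠ y ⌋ ≡ true → G v y ≡ true → ⊥
    -- A loop at `v` would be a degenerate triangle.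
    no-loop y v≡y vy with refl ← toWitness {a? = v ≟ᶠ y} (≡⇒T v≡y) = triangle-free v v v vy vy vy

  -- An edge between layers 0 and 1 has disjoint neighbourhoods, both within distance 2 of `v`.
  S₂ : ∀ x → 0 < D x → δ + δ ≤ S 2
  S₂ x 0<D with level-edge x 0<D
  ... | u , w , uw , Du , Dw = ≤-trans (+-mono-≤ (minDegree u) (minDegree w))
    (count-disjoint₂ (neighbours-within (≤-trans (≤-reflexive Du) z≤n)) (neighbours-within (≤-reflexive Dw))
      (neighbours-disjoint uw))

  prefX₂ : prefX δ 2 ≡ δ + δ
  prefX₂ = ≡-trans (cong (λ z → 1 + (δ + z)) (+-identityʳ e)) (sym (+-suc δ e))

  -- Indices 3 and 4 gain one vertex per nonempty layer, matching the entries 1, 1. From 5 on,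
  -- `S-+4` and `prefX-+4` compare steps of four; the latter starts from index 1, which leaves 0 to
  -- 4 as base cases.
  prefX≤S : ∀ k x → k < D x → prefX δ k ≤ S k
  prefX≤S 0 x k<D = S₀
  prefX≤S 1 x k<D = S₁
  prefX≤S 2 x k<D = ≤-trans (≤-reflexive prefX₂) (S₂ x (≤-trans (s≤s z≤n) k<D))
  prefX≤S 3 x k<D = ≤-trans (≤-reflexive (lemma e))
    (≤-trans (+-monoˡ-≤ 1 (prefX≤S 2 x (<⇒≤ k<D))) (S-suc 2 x (<⇒≤ k<D)))
    where
    lemma : ∀ e → 1 + (suc e + (e + (1 + 0))) ≡ 1 + (suc e + (e + 0)) + 1
    lemma = solve-∀
  prefX≤S 4 x k<D = ≤-trans (≤-reflexive (lemma e))
    (≤-trans (+-monoˡ-≤ 1 (prefX≤S 3 x (<⇒≤ k<D))) (S-suc 3 x (<⇒≤ k<D)))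
    where
    lemma : ∀ e → 1 + (suc e + (e + (1 + (1 + 0)))) ≡ 1 + (suc e + (e + (1 + 0))) + 1
    lemma = solve-∀
  prefX≤S (suc (suc (suc (suc k@(suc j))))) x k<D = ≤-trans (≤-reflexive (prefX-+4 e j))
    (≤-trans (+-monoˡ-≤ (δ + δ) (prefX≤S k x (≤-trans (m≤n+m (suc k) 4) k<D))) (S-+4 k x (<⇒≤ k<D)))

  -- Layers beyond `2 + ℓ` and the comparison with the whole of X

  module _ (ℓ r : ℕ) (n<prefX : n < prefX δ (2 + ℓ) + (δ + δ)) (n≡ : n ≡ prefX δ (2 + ℓ) + (δ + r)) where

    no-far-edge : ∀ {u w} → G u w ≡ true → 4 + ℓ ≤ D u → 4 + ℓ ≤ D w → ⊥
    no-far-edge {u} {w} uw far-u far-w = <⇒≱ n<prefX (begin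
      prefX δ (2 + ℓ) + (δ + δ) ≤⟨ +-monoˡ-≤ (δ + δ) (prefX≤S (2 + ℓ) u (<⇒≤ far-u)) ⟩
      -- The radius `D u + D w` is merely a common upper bound for the two distances.
      S (2 + ℓ) + (δ + δ)       ≤⟨ S-edge uw far-u far-w
                                    (≤-trans (m≤n+m (2 + ℓ) 2) (≤-trans far-u (m≤m+n (D u) (D w))))
                                    (m≤m+n (D u) (D w)) (m≤n+m (D w) (D u)) ⟩
      S (suc (D u + D w))       ≤⟨ S≤n _ ⟩
      n                         ∎)
      where open ≤-Reasoning

    D≤4+ℓ : ∀ x → D x ≤ 4 + ℓ
    D≤4+ℓ x = ≮⇒≥ λ far → let u , w , uw , Du , Dw = level-edge x far in
      no-far-edge uw (≤-reflexive (sym Du)) (≤-trans (n≤1+n _) (≤-reflexive (sym Dw)))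

    -- The neighbours of a vertex in layer `4 + ℓ` lie beyond layer `2 + ℓ` and, by `no-far-edge`,
    -- not beyond `3 + ℓ`. They account for the entry `δ` that follows the terms of `A`.
    last-but-one : ∀ x → 3 + ℓ < D x → prefX δ (2 + ℓ) + δ ≤ S (3 + ℓ)
    last-but-one x far with level x far
    ... | w , Dw = ≤-trans
      (+-mono-≤ (prefX≤S (2 + ℓ) x (<⇒≤ far)) (minDegree w))
      (count-disjoint₂ (λ y y≤ → within⁺ (m≤n⇒m≤1+n (within⁻ y y≤)))
        (λ y wy → within⁺ (≮⇒≥ λ far-y → no-far-edge wy (≤-reflexive (sym Dw)) far-y))
        (neighbours-beyond (≤-reflexive (sym Dw))))

    a : ℕ → ℕ
    a j = seqA δ (suc j)

    X : List ℕ
    X = 1 ∷ δ ∷ e ∷ (applyUpTo a ℓ ++ δ ∷ r ∷ [])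

    sum-X : sum X ≡ n
    sum-X = ≡-trans (sum-prefX δ ℓ r) (sym n≡)

    -- If no vertex lies beyond distance `k`, the ball is everything and has `n = sum X` vertices.
    -- Otherwise `k ≤ 2 + ℓ` is `prefX≤S`, `k = 3 + ℓ` is `last-but-one`, and larger `k` contradict
    -- `D≤4+ℓ`.
    sum-take-X≤S : ∀ k → sum (take (suc k) X) ≤ S k
    sum-take-X≤S k with any? (λ x → k <? D x)
    ... | no near = ≤-trans (sum-take≤ (suc k) X) (≤-trans (≤-reflexive sum-X) (n≤S k λ x → ≮⇒≥ λ far → near (x , far)))
    sum-take-X≤S zero          | yes (x , far) = prefX≤S 0 x far
    sum-take-X≤S (suc zero)    | yes (x , far) = ≤-trans (≤-reflexive (cong suc (+-identityʳ δ))) (prefX≤S 1 x far)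
    sum-take-X≤S (suc (suc j)) | yes (x , far) with j ≤? ℓ
    ... | yes j≤ℓ = ≤-trans
      (≤-reflexive (cong (λ ys → 1 + (δ + (e + sum ys))) (take-applyUpTo-++ a _ j≤ℓ)))
      (prefX≤S (2 + j) x far)
    ... | no j≰ℓ with m≤n⇒m<n∨m≡n (≰⇒> j≰ℓ)
    ...   | inj₁ 1+ℓ<j = ⊥-elim (<⇒≱ far (≤-trans (D≤4+ℓ x) (s≤s (s≤s 1+ℓ<j))))
    ...   | inj₂ refl = begin
      1 + (δ + (e + sum (take (suc ℓ) (applyUpTo a ℓ ++ δ ∷ r ∷ [])))) ≡⟨ cong (λ ys → 1 + (δ + (e + sum ys))) (take-applyUpTo-∷ a ℓ δ _) ⟩
      1 + (δ + (e + sum (applyUpTo a ℓ ++ δ ∷ [])))  ≡⟨ cong (λ z → 1 + (δ + (e + z))) (sum-++ (applyUpTo a ℓ) _) ⟩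
      1 + (δ + (e + (prefA δ ℓ + (δ + 0))))          ≡⟨ lemma δ e (prefA δ ℓ) ⟩
      prefX δ (2 + ℓ) + δ                            ≤⟨ last-but-one x far ⟩
      S (3 + ℓ)                                      ∎
      where
      open ≤-Reasoning
      lemma : ∀ d e p → 1 + (d + (e + (p + (d + 0)))) ≡ 1 + (d + (e + p)) + d
      lemma = solve-∀

    ∑D≤weight : ∑ D ≤ weight X
    -- Adding `S k` to both sides turns the bound on the vertices beyond distance `k` into a bound
    -- on prefixes, free of truncated subtraction.
    ∑D≤weight = ∑≤weight D X λ k → +-cancelˡ-≤ (S k) _ _ (begin
      S k + count (λ x → k <ᵇ D x)                      ≤⟨ count-disjoint₂ {d = everything} (λ _ _ → refl) (λ _ _ → refl)
                                                            (λ x near far → <⇒≱ (<ᵇ⇒< k (D x) (≡⇒T far)) (within⁻ x near)) ⟩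
      count (everything {n})                            ≡⟨ count-everything n ⟩
      n                                                 ≡⟨ sum-X ⟨
      sum X                                             ≡⟨ cong sum (take++drop≡id (suc k) X) ⟨
      sum (take (suc k) X ++ drop (suc k) X)            ≡⟨ sum-++ (take (suc k) X) (drop (suc k) X) ⟩
      sum (take (suc k) X) + sum (drop (suc k) X)       ≤⟨ +-monoˡ-≤ _ (sum-take-X≤S k) ⟩
      S k + sum (drop (suc k) X)                        ∎)
      where open ≤-Reasoning

-- Remoteness

-- `_/_` reduces to lowest terms, so the comparison is made on unnormalised fractions, where the
-- denominators agree.
/-mono-≤ : ∀ {a b} d → a ≤ b → (ℤ.+ a ℚ./ suc d) ≤ℚ (ℤ.+ b ℚ./ suc d)
/-mono-≤ {a} {b} d a≤b = ℚ.toℚᵘ-cancel-≤ (begin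
  ℚ.toℚᵘ (ℤ.+ a ℚ./ suc d) ≃⟨ ℚ.toℚᵘ-fromℚᵘ (ℚᵘ.mkℚᵘ (ℤ.+ a) d) ⟩
  ℚᵘ.mkℚᵘ (ℤ.+ a) d        ≤⟨ ℚᵘ.*≤* (ℤ.*-monoʳ-≤-nonNeg (ℤ.+ suc d) (ℤ.+≤+ a≤b)) ⟩
  ℚᵘ.mkℚᵘ (ℤ.+ b) d        ≃⟨ ℚ.toℚᵘ-fromℚᵘ (ℚᵘ.mkℚᵘ (ℤ.+ b) d) ⟨
  ℚ.toℚᵘ (ℤ.+ b ℚ./ suc d) ∎)
  where open ℚᵘ.≤-Reasoning

avgDist-mono : ∀ {n} (G H : Graph n) v u → trans G v ≤ trans H u → avgDist G v ≤ℚ avgDist H u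
avgDist-mono {suc zero}    G H v u _ = ℚ.≤-refl
avgDist-mono {suc (suc d)} G H v u σ = /-mono-≤ d σ

0≤remoteness : ∀ {n} (G : Graph n) → ℚ.0ℚ ≤ℚ remoteness G
0≤remoteness {n} G = foldr-preservesᵒ {P = ℚ.0ℚ ≤ℚ_}
  (λ { p q (inj₁ 0≤p) → ℚ.p≤q⇒p≤q⊔r q 0≤p ; p q (inj₂ 0≤q) → ℚ.p≤q⇒p≤r⊔q p 0≤q })
  ℚ.0ℚ (map (avgDist G) (allFin n)) (inj₁ ℚ.≤-refl)

avgDist≤remoteness : ∀ {n} (G : Graph n) v → avgDist G v ≤ℚ remoteness G
avgDist≤remoteness {n} G v = foldr-preservesᵒ {P = avgDist G v ≤ℚ_}
  (λ { p q (inj₁ a≤p) → ℚ.p≤q⇒p≤q⊔r q a≤p ; p q (inj₂ a≤q) → ℚ.p≤q⇒p≤r⊔q p a≤q })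
  ℚ.0ℚ (map (avgDist G) (allFin n)) (inj₂ (map⁺ (lose (∈-allFin v) ℚ.≤-refl)))

-- The orders are kept apart because `GX X` has `sum X` vertices, a number equal to the order of the
-- given graph only by a proof. Matching on that proof gives both averages the same denominator.
-- `0≤remoteness` covers the initial value of the fold.
remoteness-mono : ∀ {m n} (G : Graph m) (H : Graph n) → m ≡ n → ∀ u →
  (∀ v → trans G v ≤ trans H u) → remoteness G ≤ℚ remoteness H
remoteness-mono {m} G H refl u σ = foldr-preservesᵇ {P = _≤ℚ remoteness H} ℚ.⊔-lub (0≤remoteness H)
  (All.map⁺ (universal (λ v → ℚ.≤-trans (avgDist-mono G H v u (σ v)) (avgDist≤remoteness H u)) (allFin m)))

-- Distances from the first part of G(X)

partOf≤dist : ∀ {X} → All (1 ≤_) X → ∀ u w →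
  partOf (toℕ w) X ≤ dist (GX X) u w + partOf (toℕ u) X
partOf≤dist {X} 1≤X u w with dist (GX X) u w | leastBelow-least (λ k → reach (GX X) k u w) (suc (sum X))
... | d | least _ hit bound with m≤n⇒m<n∨m≡n bound
...   | inj₁ d<1+n = reach-GX X d {u} {w} (hit d<1+n)
-- Here `dist` is its default `suc (sum X)`, which exceeds every part index by `partOf≤`.
...   | inj₂ refl  = ≤-trans (partOf≤ (toℕ w) 1≤X) (≤-trans (m≤n⇒m≤1+n (<⇒≤ (toℕ<n w))) (m≤m+n _ _))

weight≤trans-GX : ∀ {X} → All (1 ≤_) X → ∀ u → partOf (toℕ u) X ≡ 0 → weight X ≤ trans (GX X) u
weight≤trans-GX {X} 1≤X u u∈V₀ = begin
  weight X                            ≤⟨ weight≤∑partOf X ⟩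
  ∑ {sum X} (λ w → partOf (toℕ w) X)  ≤⟨ ∑-mono {sum X} (λ w → ≤-trans (partOf≤dist 1≤X u w)
                                          (≤-reflexive (≡-trans (cong (dist (GX X) u w +_) u∈V₀) (+-identityʳ _)))) ⟩
  ∑ (dist (GX X) u)                   ≡⟨ sum-map-allFin (dist (GX X) u) ⟨
  trans (GX X) u                      ∎
  where open ≤-Reasoning

theorem3p4 : (n δ : ℕ) (G : Graph n) → IsSimple G → Connected G → TriangleFree G →
    MinDegree G δ → 3 ≤ δ → 6 * δ ≤ n →
    remoteness G ≤ℚ remoteness (GX (Xnδ n δ))
theorem3p4 n δ@(suc e) G (G-sym , _) connected triangle-free (minDegree , _) 3≤δ 6δ≤n =
  -- `Fin.zero` is the only vertex of V₀, since x₀ = 1.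
  remoteness-mono G (GX (Xnδ n δ)) n≡sum Fin.zero λ v → begin
    trans G v                     ≡⟨ sum-map-allFin (dist G v) ⟩
    ∑ (dist G v)                  ≤⟨ ∑-mono (dist≤D v) ⟩
    ∑ (D v)                       ≤⟨ Layers.∑D≤weight G G-sym triangle-free e minDegree (D v) v
                                       (D-refl v) (D-lipschitz v) (D-predecessor v) ℓ r n<prefX n≡ ⟩
    weight (Xnδ n δ)              ≤⟨ weight≤trans-GX positive Fin.zero refl ⟩
    trans (GX (Xnδ n δ)) Fin.zero ∎
  where
  open ≤-Reasoning

  -- The search for `D v w` is bounded by the length of a walk taken from connectivity, so its value
  -- is attained. `dist` searches up to `n` and, by minimality, is at most `D` whether or not it
  -- returns its default.
  D : Fin n → Fin n → ℕ
  D v w = let k , r = connected v w in proj₁ (least-true (λ k → reach G k v w) k r)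

  reach-D : ∀ v w → reach G (D v w) v w ≡ true
  reach-D v w = let k , r = connected v w in proj₁ (proj₂ (least-true (λ k → reach G k v w) k r))

  D-minimal : ∀ {v w k} → reach G k v w ≡ true → D v w ≤ k
  D-minimal {v} {w} = let k , r = connected v w in proj₂ (proj₂ (least-true (λ k → reach G k v w) k r))

  dist≤D : ∀ v w → dist G v w ≤ D v w
  dist≤D v w = Least.minimal (leastBelow-least (λ k → reach G k v w) (suc n)) (reach-D v w)

  D-refl : ∀ v → D v v ≡ 0
  D-refl v = n≤0⇒n≡0 (D-minimal {k = 0} (reach-refl G))

  D-lipschitz : ∀ v {u w} → G u w ≡ true → D v w ≤ suc (D v u)
  D-lipschitz v {u} uw = D-minimal {k = suc (D v u)} (reach-snoc G (D v u) (reach-D v u) uw)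

  D-predecessor : ∀ v {k w} → D v w ≡ suc k → ∃ λ u → G u w ≡ true × D v u ≡ k
  D-predecessor v {k} {w} Dw≡1+k with reach-unsnoc G k (subst (λ d → reach G d v w ≡ true) Dw≡1+k (reach-D v w))
  ... | inj₁ r            = ⊥-elim (1+n≰n (≤-trans (≤-reflexive (sym Dw≡1+k)) (D-minimal {k = k} r)))
  ... | inj₂ (u , r , uw) = u , uw , ≤-antisym (D-minimal {k = k} r)
    (s≤s⁻¹ (≤-trans (≤-reflexive (sym Dw≡1+k)) (D-lipschitz v uw)))

  p ℓ r : ℕ
  p = n ∸ 4 * δ
  ℓ = ellA δ p
  r = n ∸ 3 * δ ∸ prefA δ ℓ

  2≤δ : 2 ≤ δ
  2≤δ = <⇒≤ 3≤δ

  p+4δ≡n : p + 4 * δ ≡ n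
  p+4δ≡n = m∸n+n≡m (≤-trans (*-monoˡ-≤ δ {4} {6} (s≤s (s≤s (s≤s (s≤s z≤n))))) 6δ≤n)

  -- The entries 1, δ, δ - 1 sum to 2δ, so the right side is `prefA δ ℓ + 4 * δ`, which exceeds `n`
  -- by the choice of `ℓ`.
  n<prefX : n < prefX δ (2 + ℓ) + (δ + δ)
  n<prefX = begin-strict
    n                                ≡⟨ p+4δ≡n ⟨
    p + 4 * δ                        <⟨ +-monoˡ-< (4 * δ) (ellA-hit 2≤δ p) ⟩
    prefA δ ℓ + 4 * δ                ≡⟨ lemma e (prefA δ ℓ) ⟩
    prefX δ (2 + ℓ) + (δ + δ)        ∎
    where
    lemma : ∀ e p → p + 4 * suc e ≡ 1 + (suc e + (e + p)) + (suc e + suc e)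
    lemma = solve-∀

  -- Strictness makes `r` positive, and the subtractions in `r` are exact.
  room : 3 * δ + prefA δ ℓ < n
  room = begin-strict
    3 * δ + prefA δ ℓ                <⟨ +-monoʳ-< (3 * δ) (s≤s (prefA-ellA≤ 2≤δ p)) ⟩
    3 * δ + suc (p + e)              ≡⟨ lemma e p ⟩
    p + 4 * δ                        ≡⟨ p+4δ≡n ⟩
    n                                ∎
    where
    lemma : ∀ e p → 3 * suc e + suc (p + e) ≡ p + 4 * suc e
    lemma = solve-∀

  r≡ : r ≡ n ∸ (3 * δ + prefA δ ℓ)
  r≡ = ∸-+-assoc n (3 * δ) (prefA δ ℓ)

  n≡ : n ≡ prefX δ (2 + ℓ) + (δ + r)
  n≡ = begin-equality
    n                                ≡⟨ m+[n∸m]≡n (<⇒≤ room) ⟨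
    3 * δ + prefA δ ℓ + (n ∸ (3 * δ + prefA δ ℓ)) ≡⟨ cong (3 * δ + prefA δ ℓ +_) r≡ ⟨
    3 * δ + prefA δ ℓ + r            ≡⟨ lemma e (prefA δ ℓ) r ⟩
    prefX δ (2 + ℓ) + (δ + r)        ∎
    where
    lemma : ∀ e p r → 3 * suc e + p + r ≡ 1 + (suc e + (e + p)) + (suc e + r)
    lemma = solve-∀

  n≡sum : n ≡ sum (Xnδ n δ)
  n≡sum = ≡-trans n≡ (sym (sum-prefX δ ℓ r))

  positive : All (1 ≤_) (Xnδ n δ)
  positive = s≤s z≤n ∷ s≤s z≤n ∷ s≤s⁻¹ 2≤δ ∷ All.++⁺ (All.applyUpTo⁺₂ _ ℓ (λ j → seqA≥1 2≤δ (suc j)))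
    (s≤s z≤n ∷ subst (1 ≤_) (sym r≡) (m<n⇒0<n∸m room) ∷ [])
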